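{- The problems ISPNEW, ISOP and ISUP are pairwise equivalent: every instance of one can be formulated as an instance of another on the same graph so that an optimal solution of the new instance is an optimal solution of the original instance.
   Context: Let $G=(V,E)$ be a graph with vertex weights $c_i\in\mathbb{R}$ and edge weights $q^0_{ij},q^1_{ij}\in\mathbb{R}$. An independent set is a set $P\subseteq V$ containing no edge. For $P\subseteq V$ let $E_0(P)$ be the edges with no endpoint in $P$ and $E_1(P)$ the edges with exactly one endpoint in $P$. The independent set problem with node and edge weights (ISPNEW) is to find an independent set $P$ maximizing $\sum_{i\in P}c_i+\sum_{(i,j)\in E_0(P)}q^0_{ij}+\sum_{(i,j)\in E_1(P)}q^1_{ij}$. ISOP is the special case $q^1_{ij}=0$ for all edges; ISUP is the special case $q^0_{ij}=0$ for all edges. -}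

module Defs where

open import Algebra.Bundles using (AbelianGroup)
import Algebra.Properties.CommutativeMonoid.Sum as Sum
open import Data.Bool.Base using (if_then_else_)
open import Data.Fin.Base as Fin using (Fin)
open import Data.Fin.Subset using (Subset; _∈_; _∉_)
open import Data.Fin.Subset.Properties using (_∈?_)
open import Data.Nat.Base as ℕ using (ℕ; _⊔_)
import Data.Nat.Properties as ℕ
open import Data.Product.Base using (∃-syntax; _×_; _,_; proj₁; proj₂)
open import Data.Rational.Base as ℚ using (ℚ; 0ℚ; ½; ∣_∣)
import Data.Rational.Properties as ℚ
open import Data.Rational.Solver using (module +-*-Solver)
open import Data.Sum.Base using (_⊎_)
open import Data.Unit.Base using (⊤)
open import Function.Definitions using (Injective)
open import Level using (0ℓ)
open import Relation.Binary.PropositionalEquality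
  using (_≡_; refl; sym; trans; cong; subst)
open import Relation.Nullary using (¬_)
open import Relation.Nullary.Decidable using (does; ¬?; _×-dec_; _⊎-dec_)
open import Relation.Unary using (Pred; Decidable)

-- The additive ordered group of real numbers, as Cauchy sequences of
-- rationals. Two sequences denote the same real when their difference
-- tends to 0, which is the setoid equality _≈_.

record ℝ : Set where
  field
    seq    : ℕ → ℚ
    cauchy : ∀ ε → 0ℚ ℚ.< ε →
             ∃[ N ] ∀ m n → N ℕ.≤ m → N ℕ.≤ n → ∣ seq m ℚ.- seq n ∣ ℚ.< ε

open ℝ public

infix  4 _≈_ _≤_
infixl 6 _+_
infix  8 -_

record _≈_ (x y : ℝ) : Set where
  constructor mk≈
  field
    close : ∀ ε → 0ℚ ℚ.< ε →
            ∃[ N ] ∀ n → N ℕ.≤ n → ∣ seq x n ℚ.- seq y n ∣ ℚ.< ε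

open _≈_ public

-- The slack ε is needed: the order of the limits does not imply
-- seq x n ≤ seq y n for large n.
record _≤_ (x y : ℝ) : Set where
  constructor mk≤
  field
    below : ∀ ε → 0ℚ ℚ.< ε →
            ∃[ N ] ∀ n → N ℕ.≤ n → seq x n ℚ.≤ seq y n ℚ.+ ε

open _≤_ public

private
  half-pos : ∀ {ε} → 0ℚ ℚ.< ε → 0ℚ ℚ.< ½ ℚ.* ε
  half-pos {ε} 0<ε =
    subst (ℚ._< ½ ℚ.* ε) (ℚ.*-zeroʳ ½) (ℚ.*-monoʳ-<-pos ½ 0<ε)

  halves : ∀ ε → ½ ℚ.* ε ℚ.+ ½ ℚ.* ε ≡ ε
  halves ε = trans (sym (ℚ.*-distribʳ-+ ε ½ ½)) (ℚ.*-identityˡ ε)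

  ∣+∣<ε : ∀ {ε p q r} → r ≡ p ℚ.+ q →
          ∣ p ∣ ℚ.< ½ ℚ.* ε → ∣ q ∣ ℚ.< ½ ℚ.* ε → ∣ r ∣ ℚ.< ε
  ∣+∣<ε {ε} {p} {q} refl p< q< =
    ℚ.≤-<-trans (ℚ.∣p+q∣≤∣p∣+∣q∣ p q)
      (subst (∣ p ∣ ℚ.+ ∣ q ∣ ℚ.<_) (halves ε) (ℚ.+-mono-< p< q<))

  ∣-∣<ε : ∀ {ε p r} → r ≡ ℚ.- p → ∣ p ∣ ℚ.< ε → ∣ r ∣ ℚ.< ε
  ∣-∣<ε {ε} {p} refl = subst (ℚ._< ε) (sym (ℚ.∣-p∣≡∣p∣ p))

  ∣p-p∣<ε : ∀ {ε p q} → p ≡ q → 0ℚ ℚ.< ε → ∣ p ℚ.- q ∣ ℚ.< ε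
  ∣p-p∣<ε {ε} {p} refl = subst (λ r → ∣ r ∣ ℚ.< ε) (sym (ℚ.+-inverseʳ p))

  open +-*-Solver

  interchange : ∀ a b c d →
    (a ℚ.+ b) ℚ.- (c ℚ.+ d) ≡ (a ℚ.- c) ℚ.+ (b ℚ.- d)
  interchange = solve 4 (λ a b c d →
    (a :+ b) :- (c :+ d) := (a :- c) :+ (b :- d)) refl

  telescope : ∀ a b c → a ℚ.- c ≡ (a ℚ.- b) ℚ.+ (b ℚ.- c)
  telescope = solve 3 (λ a b c → a :- c := (a :- b) :+ (b :- c)) refl

  swap : ∀ a b → b ℚ.- a ≡ ℚ.- (a ℚ.- b)
  swap = solve 2 (λ a b → b :- a := :- (a :- b)) refl

  neg-diff : ∀ a b → (ℚ.- a) ℚ.- (ℚ.- b) ≡ ℚ.- (a ℚ.- b)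
  neg-diff = solve 2 (λ a b → (:- a) :- (:- b) := :- (a :- b)) refl

  ⊔ˡ : ∀ {M N n} → M ⊔ N ℕ.≤ n → M ℕ.≤ n
  ⊔ˡ {M} {N} = ℕ.≤-trans (ℕ.m≤m⊔n M N)

  ⊔ʳ : ∀ {M N n} → M ⊔ N ℕ.≤ n → N ℕ.≤ n
  ⊔ʳ {M} {N} = ℕ.≤-trans (ℕ.m≤n⊔m M N)

0ℝ : ℝ
0ℝ = record
  { seq    = λ _ → 0ℚ
  ; cauchy = λ ε 0<ε → 0 , λ _ _ _ _ → 0<ε
  }

_+_ : ℝ → ℝ → ℝ
x + y = record
  { seq    = λ n → seq x n ℚ.+ seq y n
  ; cauchy = λ ε 0<ε →
      let M , p = cauchy x (½ ℚ.* ε) (half-pos 0<ε)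
          N , q = cauchy y (½ ℚ.* ε) (half-pos 0<ε)
      in M ⊔ N , λ m n m≥ n≥ →
        ∣+∣<ε {ε} (interchange (seq x m) (seq y m) (seq x n) (seq y n))
          (p m n (⊔ˡ {M} {N} m≥) (⊔ˡ {M} {N} n≥))
          (q m n (⊔ʳ {M} {N} m≥) (⊔ʳ {M} {N} n≥))
  }

-_ : ℝ → ℝ
- x = record
  { seq    = λ n → ℚ.- seq x n
  ; cauchy = λ ε 0<ε →
      let N , p = cauchy x ε 0<ε
      in N , λ m n m≥ n≥ →
        ∣-∣<ε (neg-diff (seq x m) (seq x n)) (p m n m≥ n≥)
  }

private
  pointwise : ∀ {x y} → (∀ n → seq x n ≡ seq y n) → x ≈ y
  pointwise eq = mk≈ λ ε 0<ε → 0 , λ n _ → ∣p-p∣<ε (eq n) 0<ε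

  ≈-sym : ∀ {x y} → x ≈ y → y ≈ x
  ≈-sym {x} {y} x≈y = mk≈ λ ε 0<ε →
    let N , p = close x≈y ε 0<ε
    in N , λ n n≥ → ∣-∣<ε (swap (seq x n) (seq y n)) (p n n≥)

  ≈-trans : ∀ {x y z} → x ≈ y → y ≈ z → x ≈ z
  ≈-trans {x} {y} {z} x≈y y≈z = mk≈ λ ε 0<ε →
    let M , p = close x≈y (½ ℚ.* ε) (half-pos 0<ε)
        N , q = close y≈z (½ ℚ.* ε) (half-pos 0<ε)
    in M ⊔ N , λ n n≥ →
      ∣+∣<ε {ε} (telescope (seq x n) (seq y n) (seq z n))
        (p n (⊔ˡ {M} {N} n≥)) (q n (⊔ʳ {M} {N} n≥))

  +-cong : ∀ {x x′ y y′} → x ≈ x′ → y ≈ y′ → x + y ≈ x′ + y′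
  +-cong {x} {x′} {y} {y′} x≈x′ y≈y′ = mk≈ λ ε 0<ε →
    let M , p = close x≈x′ (½ ℚ.* ε) (half-pos 0<ε)
        N , q = close y≈y′ (½ ℚ.* ε) (half-pos 0<ε)
    in M ⊔ N , λ n n≥ →
      ∣+∣<ε {ε} (interchange (seq x n) (seq y n) (seq x′ n) (seq y′ n))
        (p n (⊔ˡ {M} {N} n≥)) (q n (⊔ʳ {M} {N} n≥))

  neg-cong : ∀ {x y} → x ≈ y → - x ≈ - y
  neg-cong {x} {y} x≈y = mk≈ λ ε 0<ε →
    let N , p = close x≈y ε 0<ε
    in N , λ n n≥ → ∣-∣<ε (neg-diff (seq x n) (seq y n)) (p n n≥)

ℝ-+-0-abelianGroup : AbelianGroup 0ℓ 0ℓ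
ℝ-+-0-abelianGroup = record
  { Carrier = ℝ
  ; _≈_     = _≈_
  ; _∙_     = _+_
  ; ε       = 0ℝ
  ; _⁻¹     = -_
  ; isAbelianGroup = record
    { isGroup = record
      { isMonoid = record
        { isSemigroup = record
          { isMagma = record
            { isEquivalence = record
              { refl  = pointwise (λ _ → refl)
              ; sym   = ≈-sym
              ; trans = ≈-trans
              }
            ; ∙-cong = +-cong
            }
          ; assoc = λ x y z → pointwise (λ n → ℚ.+-assoc (seq x n) (seq y n) (seq z n))
          }
        ; identity = (λ x → pointwise (λ n → ℚ.+-identityˡ (seq x n)))
                   , (λ x → pointwise (λ n → ℚ.+-identityʳ (seq x n)))
        }
      ; inverse = (λ x → pointwise (λ n → ℚ.+-inverseˡ (seq x n)))
                , (λ x → pointwise (λ n → ℚ.+-inverseʳ (seq x n)))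
      ; ⁻¹-cong = neg-cong
      }
    ; comm = λ x y → pointwise (λ n → ℚ.+-comm (seq x n) (seq y n))
    }
  }

open Sum (AbelianGroup.commutativeMonoid ℝ-+-0-abelianGroup) public using (sum)

sumOver : ∀ {n} {S : Pred (Fin n) 0ℓ} → Decidable S → (Fin n → ℝ) → ℝ
sumOver S? f = sum (λ i → if does (S? i) then f i else 0ℝ)

-- The unordered edge {i , j} is stored once, as (i , j) with i < j; this
-- excludes loops, and injectivity of ends excludes parallel edges.
record Graph : Set where
  field
    order    : ℕ
    size     : ℕ
    ends     : Fin size → Fin order × Fin order
    ordered  : ∀ e → proj₁ (ends e) Fin.< proj₂ (ends e)
    distinct : Injective _≡_ _≡_ ends

  V : Set
  V = Fin order

  E : Set
  E = Fin size

  fst snd : E → V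
  fst e = proj₁ (ends e)
  snd e = proj₂ (ends e)

module _ (G : Graph) where
  open Graph G

  Independent : Subset order → Set
  Independent P = ∀ e → ¬ (fst e ∈ P × snd e ∈ P)

  E₀ E₁ : Subset order → Pred E 0ℓ
  E₀ P e = fst e ∉ P × snd e ∉ P
  E₁ P e = (fst e ∈ P × snd e ∉ P) ⊎ (fst e ∉ P × snd e ∈ P)

  E₀? : ∀ P → Decidable (E₀ P)
  E₀? P e = ¬? (fst e ∈? P) ×-dec ¬? (snd e ∈? P)

  E₁? : ∀ P → Decidable (E₁ P)
  E₁? P e = (fst e ∈? P ×-dec ¬? (snd e ∈? P))
      ⊎-dec (¬? (fst e ∈? P) ×-dec snd e ∈? P)

  record Weights : Set where
    field
      c     : V → ℝ
      q⁰ q¹ : E → ℝ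

  objective : Weights → Subset order → ℝ
  objective w P = sumOver (_∈? P) c + sumOver (E₀? P) q⁰ + sumOver (E₁? P) q¹
    where open Weights w

  Optimal : Weights → Subset order → Set
  Optimal w P = Independent P ×
                (∀ Q → Independent Q → objective w Q ≤ objective w P)

-- A problem is given by the weights it admits on each graph; feasible
-- solutions and objective are always those above.
Problem : Set₁
Problem = ∀ G → Weights G → Set

ISPNEW ISOP ISUP : Problem
ISPNEW G w = ⊤
ISOP   G w = ∀ e → Weights.q¹ w e ≈ 0ℝ
ISUP   G w = ∀ e → Weights.q⁰ w e ≈ 0ℝ

infix 4 _ReducesTo_ _EquivalentTo_

_ReducesTo_ : Problem → Problem → Set
A ReducesTo B = ∀ G (w : Weights G) → A G w →
  ∃[ w′ ] B G w′ × (∀ P → Optimal G w′ P → Optimal G w P)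

_EquivalentTo_ : Problem → Problem → Set
A EquivalentTo B = (A ReducesTo B) × (B ReducesTo A)

{-# OPTIONS --safe #-}
-- The edges at an independent set P split into E₀ P and E₁ P. Subtracting d e
-- from both q⁰ e and q¹ e therefore lowers the objective of every independent
-- set by the same constant sum d, and preserves the optimal solutions. The
-- choice d = q¹ yields an ISOP instance, the choice d = q⁰ an ISUP instance.
-- The shift is an exact equality between the rational sequences of the
-- objectives, so no estimate is needed.
module Submission where

open import Defs
open import Algebra.Bundles using (AbelianGroup)
import Algebra.Properties.CommutativeMonoid.Sum as Sum
import Algebra.Properties.CommutativeSemigroup as CommutativeSemigroup
import Algebra.Properties.Group as Group
open import Data.Bool.Base using (Bool; not; true; false; if_then_else_)
open import Data.Bool.Properties using (if-float)
open import Data.Fin.Base using (Fin; zero; suc)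
open import Data.Fin.Subset.Properties using (_∈?_)
import Data.Nat.Base as ℕ
open import Data.Product.Base using (_×_; _,_)
open import Data.Rational.Base as ℚ using (0ℚ)
import Data.Rational.Properties as ℚ
open import Data.Unit.Base using (tt)
open import Function.Base using (_∘_)
open import Level using (0ℓ)
open import Relation.Binary.PropositionalEquality
  using (_≡_; refl; cong; cong₂; module ≡-Reasoning)
import Relation.Binary.Reasoning.Setoid as SetoidReasoning
open import Relation.Nullary using (contradiction)
open import Relation.Nullary.Decidable using (does; yes; no)
open import Relation.Unary using (Pred; Decidable)

module _ {c ℓ} (A : AbelianGroup c ℓ) where
  open AbelianGroup A
    using (Carrier; setoid; ε; _∙_; _⁻¹; identityˡ; identityʳ; assoc; ∙-congˡ; ∙-congʳ)
    renaming (_≈_ to _≈ᴬ_)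
  open Group (AbelianGroup.group A) using (//-rightDividesˡ)
  open Sum (AbelianGroup.commutativeMonoid A)
    using (sum-cong-≋; ∑-distrib-+) renaming (sum to sumᴬ)
  open SetoidReasoning setoid

  -- Exactly one of the two conditions holds, so exactly one copy of `z ⁻¹` occurs on the right, and
  -- the final `z` cancels it.
  complementary-terms : ∀ {b₀ b₁} → b₁ ≡ not b₀ → ∀ x y z →
    (if b₀ then x else ε) ∙ (if b₁ then y else ε) ≈ᴬ
    (if b₀ then x ∙ z ⁻¹ else ε) ∙ (if b₁ then y ∙ z ⁻¹ else ε) ∙ z
  complementary-terms {true} refl x y z = begin
    x ∙ ε              ≈⟨ identityʳ x ⟩
    x                  ≈⟨ //-rightDividesˡ z x ⟨
    x ∙ z ⁻¹ ∙ z       ≈⟨ ∙-congʳ (identityʳ (x ∙ z ⁻¹)) ⟨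
    x ∙ z ⁻¹ ∙ ε ∙ z   ∎
  complementary-terms {false} refl x y z = begin
    ε ∙ y                 ≈⟨ identityˡ y ⟩
    y                     ≈⟨ //-rightDividesˡ z y ⟨
    y ∙ z ⁻¹ ∙ z          ≈⟨ ∙-congʳ (identityˡ (y ∙ z ⁻¹)) ⟨
    ε ∙ (y ∙ z ⁻¹) ∙ z    ∎

  -- Both sums are merged into one so that `complementary-terms` applies index by index; the
  -- leftover terms `h i` then collect into a constant free of `b₀` and `b₁`. The leading `a` stands
  -- for the vertex part of the objective.
  complementary-sums : ∀ {n} {b₀ b₁ : Fin n → Bool} → (∀ i → b₁ i ≡ not (b₀ i)) →
    ∀ a (f g h : Fin n → Carrier) →
    a ∙ sumᴬ (λ i → if b₀ i then f i else ε) ∙ sumᴬ (λ i → if b₁ i then g i else ε) ≈ᴬ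
    a ∙ sumᴬ (λ i → if b₀ i then f i ∙ h i ⁻¹ else ε)
      ∙ sumᴬ (λ i → if b₁ i then g i ∙ h i ⁻¹ else ε) ∙ sumᴬ h
  complementary-sums {b₀ = b₀} {b₁} b₁≡notb₀ a f g h = begin
    a ∙ sumᴬ s₀ ∙ sumᴬ s₁                      ≈⟨ assoc a (sumᴬ s₀) (sumᴬ s₁) ⟩
    a ∙ (sumᴬ s₀ ∙ sumᴬ s₁)                    ≈⟨ ∙-congˡ (∑-distrib-+ s₀ s₁) ⟨
    a ∙ sumᴬ (λ i → s₀ i ∙ s₁ i)               ≈⟨ ∙-congˡ (sum-cong-≋ λ i →
                                                    complementary-terms (b₁≡notb₀ i) (f i) (g i) (h i)) ⟩
    a ∙ sumᴬ (λ i → t₀ i ∙ t₁ i ∙ h i)         ≈⟨ ∙-congˡ (∑-distrib-+ (λ i → t₀ i ∙ t₁ i) h) ⟩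
    a ∙ (sumᴬ (λ i → t₀ i ∙ t₁ i) ∙ sumᴬ h)    ≈⟨ ∙-congˡ (∙-congʳ (∑-distrib-+ t₀ t₁)) ⟩
    a ∙ (sumᴬ t₀ ∙ sumᴬ t₁ ∙ sumᴬ h)           ≈⟨ assoc a (sumᴬ t₀ ∙ sumᴬ t₁) (sumᴬ h) ⟨
    a ∙ (sumᴬ t₀ ∙ sumᴬ t₁) ∙ sumᴬ h           ≈⟨ ∙-congʳ (assoc a (sumᴬ t₀) (sumᴬ t₁)) ⟨
    a ∙ sumᴬ t₀ ∙ sumᴬ t₁ ∙ sumᴬ h             ∎
    where
    s₀ s₁ t₀ t₁ : Fin _ → Carrier
    s₀ i = if b₀ i then f i else ε
    s₁ i = if b₁ i then g i else ε
    t₀ i = if b₀ i then f i ∙ h i ⁻¹ else ε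
    t₁ i = if b₁ i then g i ∙ h i ⁻¹ else ε

-- Rewrapping the proof makes Agda compare only the sequences; comparing the
-- reals themselves, with their Cauchy proofs, does not terminate in practice.
+-inverseʳ : ∀ x → x + - x ≈ 0ℝ
+-inverseʳ x = mk≈ (close (AbelianGroup.inverseʳ ℝ-+-0-abelianGroup x))

open Sum (AbelianGroup.commutativeMonoid ℚ.+-0-abelianGroup)
  using () renaming (sum to sumℚ)

-- Addition of reals is termwise, so evaluation at an index passes through finite sums. This moves
-- the comparison of objectives into ℚ, where it holds up to `≡`.
seq-sum : ∀ {n} (f : Fin n → ℝ) m → seq (sum f) m ≡ sumℚ (λ i → seq (f i) m)
seq-sum {ℕ.zero}  f m = refl
seq-sum {ℕ.suc n} f m = cong (seq (f zero) m ℚ.+_) (seq-sum (f ∘ suc) m)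

seq-sumOver : ∀ {n} {S : Pred (Fin n) 0ℓ} (S? : Decidable S) (f : Fin n → ℝ) m →
  seq (sumOver S? f) m ≡ sumℚ (λ i → if does (S? i) then seq (f i) m else 0ℚ)
seq-sumOver {ℕ.zero}  S? f m = refl
seq-sumOver {ℕ.suc n} S? f m = cong₂ ℚ._+_
  (if-float (λ x → seq x m) (does (S? zero)))
  (seq-sumOver (S? ∘ suc) (f ∘ suc) m)

module _ (G : Graph) where
  open Graph G

  -- This is where independence enters: an edge with both ends in `P` would lie in neither `E₀` nor
  -- `E₁`, and its weight would not be shifted.
  independent⇒E₁≡notE₀ : ∀ {P} → Independent G P →
    ∀ e → does (E₁? G P e) ≡ not (does (E₀? G P e))
  independent⇒E₁≡notE₀ {P} indP e with fst e ∈? P | snd e ∈? P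
  ... | yes i∈P | yes j∈P = contradiction (i∈P , j∈P) (indP e)
  ... | yes _   | no _    = refl
  ... | no _    | yes _   = refl
  ... | no _    | no _    = refl

  lower : (E → ℝ) → Weights G → Weights G
  lower d w = record { c = c ; q⁰ = λ e → q⁰ e + - d e ; q¹ = λ e → q¹ e + - d e }
    where open Weights w

  seq-objective : ∀ w P m → let open Weights w in
    seq (objective G w P) m ≡
    seq (sumOver (_∈? P) c) m
      ℚ.+ sumℚ (λ e → if does (E₀? G P e) then seq (q⁰ e) m else 0ℚ)
      ℚ.+ sumℚ (λ e → if does (E₁? G P e) then seq (q¹ e) m else 0ℚ)
  seq-objective w P m = cong₂ (λ x y → seq (sumOver (_∈? P) c) m ℚ.+ x ℚ.+ y)
    (seq-sumOver (E₀? G P) q⁰ m) (seq-sumOver (E₁? G P) q¹ m)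
    where open Weights w

  -- The offset `sum d` runs over all edges and so is the same for every independent `P`.
  objective-lower : ∀ w d {P} → Independent G P → ∀ m →
    seq (objective G w P) m ≡ seq (objective G (lower d w) P) m ℚ.+ seq (sum d) m
  objective-lower w d {P} indP m = begin
    seq (objective G w P) m
      ≡⟨ seq-objective w P m ⟩
    _
      ≡⟨ complementary-sums ℚ.+-0-abelianGroup
           {b₀ = does ∘ E₀? G P} {b₁ = does ∘ E₁? G P} (independent⇒E₁≡notE₀ indP)
           (seq (sumOver (_∈? P) c) m)
           (λ e → seq (q⁰ e) m) (λ e → seq (q¹ e) m) (λ e → seq (d e) m) ⟩
    _
      ≡⟨ cong₂ ℚ._+_ (seq-objective (lower d w) P m) (seq-sum d m) ⟨
    seq (objective G (lower d w) P) m ℚ.+ seq (sum d) m ∎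
    where
    open ≡-Reasoning
    open Weights w

  lower-optimal : ∀ w d {P} → Optimal G (lower d w) P → Optimal G w P
  lower-optimal w d {P} (indP , maxP) = indP , λ Q indQ → mk≤ λ ε 0<ε →
    let N , Q≤P+ε = below (maxP Q indQ) ε 0<ε
    -- The threshold for the lowered weights serves unchanged, because the shift is exact at every
    -- index.
    in N , λ n n≥N → begin
      seq (objective G w Q) n
        ≡⟨ objective-lower w d indQ n ⟩
      seq (objective G (lower d w) Q) n ℚ.+ seq (sum d) n
        ≤⟨ ℚ.+-monoˡ-≤ (seq (sum d) n) (Q≤P+ε n n≥N) ⟩
      seq (objective G (lower d w) P) n ℚ.+ ε ℚ.+ seq (sum d) n
        ≡⟨ xy∙z≈xz∙y (seq (objective G (lower d w) P) n) ε (seq (sum d) n) ⟩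
      seq (objective G (lower d w) P) n ℚ.+ seq (sum d) n ℚ.+ ε
        ≡⟨ cong (ℚ._+ ε) (objective-lower w d indP n) ⟨
      seq (objective G w P) n ℚ.+ ε ∎
    where
    open ℚ.≤-Reasoning
    open CommutativeSemigroup (AbelianGroup.commutativeSemigroup ℚ.+-0-abelianGroup)
      using (xy∙z≈xz∙y)

-- `ISPNEW` admits all weights, so the instance is kept as it is.
reducesTo-ISPNEW : ∀ {A} → A ReducesTo ISPNEW
reducesTo-ISPNEW G w _ = w , tt , λ _ opt → opt

reducesTo-ISOP : ∀ {A} → A ReducesTo ISOP
reducesTo-ISOP G w _ =
  lower G q¹ w , (λ e → +-inverseʳ (q¹ e)) , λ _ → lower-optimal G w q¹
  where open Weights w

reducesTo-ISUP : ∀ {A} → A ReducesTo ISUP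
reducesTo-ISUP G w _ =
  lower G q⁰ w , (λ e → +-inverseʳ (q⁰ e)) , λ _ → lower-optimal G w q⁰
  where open Weights w

theorem8 : (ISPNEW EquivalentTo ISOP) × (ISPNEW EquivalentTo ISUP) × (ISOP EquivalentTo ISUP)
theorem8 =
    (reducesTo-ISOP {ISPNEW} , reducesTo-ISPNEW {ISOP})
  , (reducesTo-ISUP {ISPNEW} , reducesTo-ISPNEW {ISUP})
  -- Between `ISOP` and `ISUP` the shift turns the one nonzero kind of edge weight into the other
  -- kind with opposite sign.
  , (reducesTo-ISUP {ISOP}   , reducesTo-ISOP {ISUP})
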